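{- Consider directed walks on the nonnegative integers (altitudes) with jumps $-2$ and $+5$ whose altitude stays $\ge 0$ at all times. Let $F_0(z)=\sum_{n\ge 0} f_n z^n$, where $f_n$ is the number of such walks with $n$ jumps that start at altitude $3$ and end at altitude $0$; let $G_1(z)=\sum_{n\ge0} g_n z^n$, where $g_n$ is the number of such walks with $n$ jumps that start at altitude $4$ and end at altitude $1$. Let $u_1=u_1(z)$ and $u_2=u_2(z)$ be the two small roots of $1-zP(u)=0$, where $P(u)=u^{ -2}+u^5$. Then $$F_0(z)=-\frac{u_1u_2\,(u_1^4-u_2^4)}{z\,(u_1-u_2)},\qquad G_1(z)=\frac{u_1^6-u_2^6}{z\,(u_1-u_2)}.$$
   Context: The equation $1-zP(u)=0$, equivalently $u^2=z(1+u^7)$, has seven solutions $u(z)$ (as Puiseux series at $z=0$). The two small roots $u_1(z),u_2(z)$ are those tending to $0$ as $z\to0$; the other five tend to infinity. -}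

module Defs where

open import Algebra.Apartness.Bundles using (HeytingField; HeytingCommutativeRing)
open import Algebra.Bundles using (CommutativeRing)
open import Algebra.Bundles.Raw using (RawRing)
import Algebra.Definitions.RawSemiring as RawSemiringDefs
import Algebra.Properties.Monoid.Sum as MonoidSum
import Algebra.Properties.Monoid.Mult as MonoidMult
open import Data.Fin.Base using (toℕ)
open import Data.Integer.Base as ℤ using (ℤ; +_; -[1+_]; 0ℤ)
import Data.Integer.Properties as ℤ
open import Data.List.Base using (List; []; _∷_; _++_; map; filter; length)
open import Data.Nat.Base as ℕ using (ℕ; zero; suc; NonZero; _∸_)
open import Data.Nat.Divisibility using (_∣?_; quotient)
open import Data.Product.Base using (_×_; ∃-syntax)
open import Data.Vec.Base using (Vec; []; _∷_)
open import Level using (_⊔_)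
open import Relation.Binary.PropositionalEquality.Core using (_≡_)
open import Relation.Nullary using (¬_; Dec; yes; no)
open import Relation.Nullary.Decidable using (_×-dec_)

data Jump : Set where
  down up : Jump

size : Jump → ℤ
size down = -[1+ 1 ]
size up   = + 5

-- The walk starting at altitude a with the given jumps ends at altitude b, and
-- every altitude visited, including the first and the last, is ≥ 0.
IsWalk : ∀ {n} → ℤ → ℤ → Vec Jump n → Set
IsWalk a b []       = 0ℤ ℤ.≤ a × a ≡ b
IsWalk a b (j ∷ js) = 0ℤ ℤ.≤ a × IsWalk (a ℤ.+ size j) b js

isWalk? : ∀ {n} a b (js : Vec Jump n) → Dec (IsWalk a b js)
isWalk? a b []       = (0ℤ ℤ.≤? a) ×-dec (a ℤ.≟ b)
isWalk? a b (j ∷ js) = (0ℤ ℤ.≤? a) ×-dec isWalk? (a ℤ.+ size j) b js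

-- Each of the 2ⁿ jump sequences occurs exactly once.
jumpSequences : ∀ n → List (Vec Jump n)
jumpSequences zero    = [] ∷ []
jumpSequences (suc n) =
  map (down ∷_) (jumpSequences n) ++ map (up ∷_) (jumpSequences n)

numWalks : ℤ → ℤ → ℕ → ℕ
numWalks a b n = length (filter (isWalk? a b) (jumpSequences n))

CharacteristicZero : ∀ {c ℓ₁ ℓ₂} → HeytingField c ℓ₁ ℓ₂ → Set ℓ₁
CharacteristicZero K = ∀ n → ¬ (suc n ×ᴷ 1# ≈ 0#)
  where
  open HeytingField K using (heytingCommutativeRing)
  open CommutativeRing
    (HeytingCommutativeRing.commutativeRing heytingCommutativeRing)
    using (_≈_; 0#; 1#; +-monoid)
  open MonoidMult +-monoid using () renaming (_×_ to infixr 8 _×ᴷ_)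

-- The field K((t)) with t = z^(1/e).  The field of Puiseux series in z over K is
-- the union of these over all e ≥ 1, so finitely many Puiseux series always lie
-- in a common one.
module Puiseux {c ℓ₁ ℓ₂} (K : HeytingField c ℓ₁ ℓ₂) (e : ℕ) .{{_ : NonZero e}} where

  private
    module K = CommutativeRing
      (HeytingCommutativeRing.commutativeRing
        (HeytingField.heytingCommutativeRing K))
  open MonoidSum K.+-monoid using (sum⁺-syntax)
  open MonoidMult K.+-monoid using () renaming (_×_ to infixr 8 _×ᴷ_)

  -- (pole , num) represents t^(- pole) · Σₙ num n · tⁿ; num 0 may vanish.
  record Series : Set c where
    constructor _,_
    field
      pole : ℕ
      num  : ℕ → K.Carrier
  open Series public

  -- The coefficient of t^k.
  coeff : Series → ℤ → K.Carrier
  coeff x k with k ℤ.+ + pole x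
  ... | + n      = num x n
  ... | -[1+ _ ] = K.0#

  -- Multiplication of a power series by t^m.
  shift : ℕ → (ℕ → K.Carrier) → ℕ → K.Carrier
  shift zero    f n       = f n
  shift (suc m) f zero    = K.0#
  shift (suc m) f (suc n) = shift m f n

  constant : K.Carrier → ℕ → K.Carrier
  constant a zero    = a
  constant a (suc n) = K.0#

  seriesRing : RawRing c ℓ₁
  seriesRing = record
    { Carrier = Series
    ; _≈_     = λ x y → ∀ k → coeff x k K.≈ coeff y k
    ; _+_     = λ x y → (pole x ℕ.+ pole y) ,
                  (λ n → shift (pole y) (num x) n K.+ shift (pole x) (num y) n)
    ; _*_     = λ x y → (pole x ℕ.+ pole y) ,
                  (λ n → ∑[ i ≤ n ] (num x (toℕ i) K.* num y (n ∸ toℕ i)))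
    ; -_      = λ x → pole x , (λ n → K.- num x n)
    ; 0#      = 0 , constant K.0#
    ; 1#      = 0 , constant K.1#
    }

  open RawRing seriesRing public
    using (_≈_; _≉_; _+_; _*_; -_; 0#; 1#)
  open RawSemiringDefs (RawRing.rawSemiring seriesRing) public using (_^_)

  infixl 6 _-_
  _-_ : Series → Series → Series
  x - y = x + - y

  z : Series
  z = 0 , shift e (constant K.1#)

  -- Σₙ f n · zⁿ = Σₙ f n · t^(e n).
  generatingFunction : (ℕ → ℕ) → Series
  generatingFunction f = 0 , coefficient
    where
    coefficient : ℕ → K.Carrier
    coefficient n with e ∣? n
    ... | yes e∣n = f (quotient e∣n) ×ᴷ K.1#
    ... | no  _   = K.0#

  -- P(u) = u⁻² + u⁵, with the inverse of u passed as second argument.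
  P : Series → Series → Series
  P u u⁻¹ = u⁻¹ ^ 2 + u ^ 5

  IsRoot : Series → Set (c ⊔ ℓ₁)
  IsRoot u = ∃[ u⁻¹ ] (u * u⁻¹ ≈ 1#) × (1# - z * P u u⁻¹ ≈ 0#)

  -- u → 0 as z → 0: only positive exponents occur.
  TendsToZero : Series → Set ℓ₁
  TendsToZero u = ∀ k → k ℤ.≤ 0ℤ → coeff u k K.≈ K.0#

  IsSmallRoot : Series → Set (c ⊔ ℓ₁)
  IsSmallRoot u = IsRoot u × TendsToZero u

  -- q = a / b, including that the denominator b is nonzero.
  infix 4 _≈_÷_
  _≈_÷_ : Series → Series → Series → Set ℓ₁
  q ≈ a ÷ b = b ≉ 0# × q * b ≈ a

{-# OPTIONS --safe #-}
module Submission where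

-- The kernel method, without division by the kernel.  Let H_{a,b} be the
-- generating function of the walks from a to b.  Removing the first jump gives
-- H_{a,b} = [a = b] + z (H_{a-2,b} + H_{a+5,b}), where H_{a-2,b} = 0 if a < 2.
-- For a small root u, the equation u² = z (1 + u⁷) shows that u^{a+2} satisfies
-- the same recursion in a as z (H_{a,0} + u H_{a,1}).  Each use of the recursion
-- gains a factor z, so the two families agree modulo every power of z and
--   u^{a+2} = z (H_{a,0} + u H_{a,1}).
-- For a = 3 and a = 4 this is, with u = u₁ and u = u₂, a linear system from
-- which H_{3,0} = F₀ and H_{4,1} = G₁ are eliminated.

open import Defs
open import Algebra.Apartness.Bundles using (HeytingField; HeytingCommutativeRing)
open import Algebra.Bundles using (CommutativeRing)
import Algebra.Properties.Group as GroupProperties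
import Algebra.Properties.Monoid.Mult as MonoidMult
import Algebra.Properties.Monoid.Sum as MonoidSum
import Algebra.Properties.Semiring.Exp as SemiringExp
import Algebra.Properties.Ring as RingProperties
import Algebra.Solver.Ring.NaturalCoefficients.Default as NaturalCoefficients
open import Data.Fin.Base using (toℕ)
open import Data.Integer.Base as ℤ using (ℤ; +_; -[1+_]; 0ℤ)
import Data.Integer.Properties as ℤ
open import Data.List.Base using (List; []; _∷_; map; filter; length)
open import Data.List.Properties using (filter-++; length-++)
open import Data.Nat.Base as ℕ using (ℕ; zero; suc; NonZero; _∸_)
import Data.Nat.Properties as ℕ
open import Data.Nat.Divisibility
  using (_∣_; _∣?_; divides; divides-refl; >⇒∤; ∣m+n∣m⇒∣n; ∣-refl)
open import Data.Product.Base using (_×_; _,_; proj₁; proj₂)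
open import Data.Sum.Base using (inj₁; inj₂)
open import Data.Vec.Base using (Vec)
open import Function.Base using (_∘_)
open import Relation.Binary.PropositionalEquality as ≡ using (_≡_)
open import Relation.Nullary using (¬_; yes; no; contradiction)
open import Relation.Unary using (Pred; Decidable)
import Relation.Binary.Reasoning.Setoid as SetoidReasoning

-- Formal power series in t over `K` as a commutative ring.

module PowerSeries {c ℓ₁ ℓ₂} (K : HeytingField c ℓ₁ ℓ₂) (e : ℕ) .{{_ : NonZero e}} where

  open Puiseux K e using (shift; constant)
  private
    module K = CommutativeRing
      (HeytingCommutativeRing.commutativeRing
        (HeytingField.heytingCommutativeRing K))
    module S = NaturalCoefficients K.commutativeSemiring
  open MonoidSum K.+-monoid using (sum⁺-syntax)
  open SetoidReasoning K.setoid

  PS : Set c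
  PS = ℕ → K.Carrier

  infix 4 _≐_
  _≐_ : PS → PS → Set ℓ₁
  f ≐ g = ∀ n → f n K.≈ g n

  infixl 6 _⊕_
  _⊕_ : PS → PS → PS
  (f ⊕ g) n = f n K.+ g n

  infixl 7 _⊛_
  _⊛_ : PS → PS → PS
  (f ⊛ g) n = ∑[ i ≤ n ] (f (toℕ i) K.* g (n ∸ toℕ i))

  tail : PS → PS
  tail f = f ∘ suc

  ⊛-cong : ∀ {f f′ g g′} → f ≐ f′ → g ≐ g′ → f ⊛ g ≐ f′ ⊛ g′
  ⊛-cong p q zero    = K.+-congʳ (K.*-cong (p 0) (q 0))
  ⊛-cong p q (suc n) =
    K.+-cong (K.*-cong (p 0) (q (suc n))) (⊛-cong (p ∘ suc) q n)

  -- The sum unfolds by computation at its first term, index 0 of `f`; here the last term, index 0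
  -- of `g`, is split off instead. Commutativity exchanges the two ends.
  ⊛-sucʳ : ∀ f g n → (f ⊛ g) (suc n) K.≈ f (suc n) K.* g 0 K.+ (f ⊛ tail g) n
  ⊛-sucʳ f g zero    =
    S.solve 2 (λ x y → x S.:+ (y S.:+ S.con 0) S.:= y S.:+ (x S.:+ S.con 0))
      K.refl _ _
  ⊛-sucʳ f g (suc n) = begin
    f 0 K.* g (suc (suc n)) K.+ (tail f ⊛ g) (suc n)
      ≈⟨ K.+-congˡ (⊛-sucʳ (tail f) g n) ⟩
    f 0 K.* g (suc (suc n)) K.+
      (f (suc (suc n)) K.* g 0 K.+ (tail f ⊛ tail g) n)
      ≈⟨ S.solve 3 (λ x y w → x S.:+ (y S.:+ w) S.:= y S.:+ (x S.:+ w))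
           K.refl _ _ _ ⟩
    f (suc (suc n)) K.* g 0 K.+ (f ⊛ tail g) (suc n)  ∎

  ⊛-comm : ∀ f g → f ⊛ g ≐ g ⊛ f
  ⊛-comm f g zero    = K.+-congʳ (K.*-comm _ _)
  ⊛-comm f g (suc n) = begin
    f 0 K.* g (suc n) K.+ (tail f ⊛ g) n
      ≈⟨ K.+-cong (K.*-comm _ _) (⊛-comm (tail f) g n) ⟩
    g (suc n) K.* f 0 K.+ (g ⊛ tail f) n
      ≈⟨ ⊛-sucʳ g f n ⟨
    (g ⊛ f) (suc n)  ∎

  ⊛-distribʳ : ∀ f g h → (g ⊕ h) ⊛ f ≐ g ⊛ f ⊕ h ⊛ f
  ⊛-distribʳ f g h zero    =
    S.solve 3 (λ a b d → (b S.:+ d) S.:* a S.:+ S.con 0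
      S.:= (b S.:* a S.:+ S.con 0) S.:+ (d S.:* a S.:+ S.con 0))
      K.refl _ _ _
  ⊛-distribʳ f g h (suc n) = begin
    (g 0 K.+ h 0) K.* f (suc n) K.+ ((tail g ⊕ tail h) ⊛ f) n
      ≈⟨ K.+-congˡ (⊛-distribʳ f (tail g) (tail h) n) ⟩
    (g 0 K.+ h 0) K.* f (suc n) K.+ ((tail g ⊛ f) n K.+ (tail h ⊛ f) n)
      ≈⟨ S.solve 5 (λ a b d x y → (b S.:+ d) S.:* a S.:+ (x S.:+ y)
           S.:= (b S.:* a S.:+ x) S.:+ (d S.:* a S.:+ y)) K.refl _ _ _ _ _ ⟩
    (g ⊛ f) (suc n) K.+ (h ⊛ f) (suc n)  ∎

  ⊛-scaleˡ : ∀ a f g → (λ n → a K.* f n) ⊛ g ≐ (λ n → a K.* (f ⊛ g) n)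
  ⊛-scaleˡ a f g zero    =
    S.solve 3 (λ a x y → a S.:* x S.:* y S.:+ S.con 0
      S.:= a S.:* (x S.:* y S.:+ S.con 0)) K.refl _ _ _
  ⊛-scaleˡ a f g (suc n) = begin
    a K.* f 0 K.* g (suc n) K.+ ((λ m → a K.* tail f m) ⊛ g) n
      ≈⟨ K.+-congˡ (⊛-scaleˡ a (tail f) g n) ⟩
    a K.* f 0 K.* g (suc n) K.+ a K.* (tail f ⊛ g) n
      ≈⟨ S.solve 4 (λ a x y w → a S.:* x S.:* y S.:+ a S.:* w
           S.:= a S.:* (x S.:* y S.:+ w)) K.refl _ _ _ _ ⟩
    a K.* (f ⊛ g) (suc n)  ∎

  -- Induction on the index. The tail of `f ⊛ g` is by computation `f 0` times `tail g` plus
  -- `tail f ⊛ g`, so distributivity and scaling reduce the claim to the same one for `tail f`.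
  ⊛-assoc : ∀ f g h → (f ⊛ g) ⊛ h ≐ f ⊛ (g ⊛ h)
  ⊛-assoc f g h zero    =
    S.solve 3 (λ a b d → (a S.:* b S.:+ S.con 0) S.:* d S.:+ S.con 0
      S.:= a S.:* (b S.:* d S.:+ S.con 0) S.:+ S.con 0) K.refl _ _ _
  ⊛-assoc f g h (suc n) = begin
    (f 0 K.* g 0 K.+ K.0#) K.* h (suc n) K.+
      (((λ m → f 0 K.* tail g m) ⊕ tail f ⊛ g) ⊛ h) n
      ≈⟨ K.+-congˡ (⊛-distribʳ h (λ m → f 0 K.* tail g m) (tail f ⊛ g) n) ⟩
    (f 0 K.* g 0 K.+ K.0#) K.* h (suc n) K.+
      (((λ m → f 0 K.* tail g m) ⊛ h) n K.+ ((tail f ⊛ g) ⊛ h) n)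
      ≈⟨ K.+-congˡ (K.+-cong (⊛-scaleˡ (f 0) (tail g) h n)
                             (⊛-assoc (tail f) g h n)) ⟩
    (f 0 K.* g 0 K.+ K.0#) K.* h (suc n) K.+
      (f 0 K.* (tail g ⊛ h) n K.+ (tail f ⊛ (g ⊛ h)) n)
      ≈⟨ S.solve 5 (λ a b d x y →
           (a S.:* b S.:+ S.con 0) S.:* d S.:+ (a S.:* x S.:+ y)
           S.:= a S.:* (b S.:* d S.:+ x) S.:+ y) K.refl _ _ _ _ _ ⟩
    (f ⊛ (g ⊛ h)) (suc n)  ∎

  ⊛-zeroˡ : ∀ f g → (∀ n → f n K.≈ K.0#) → ∀ n → (f ⊛ g) n K.≈ K.0#
  ⊛-zeroˡ f g f≈0 zero    =
    K.trans (K.+-identityʳ _) (K.trans (K.*-congʳ (f≈0 0)) (K.zeroˡ _))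
  ⊛-zeroˡ f g f≈0 (suc n) = K.trans
    (K.+-cong (K.trans (K.*-congʳ (f≈0 0)) (K.zeroˡ _))
              (⊛-zeroˡ (tail f) g (f≈0 ∘ suc) n))
    (K.+-identityʳ _)

  ⊛-constantˡ : ∀ a f → constant a ⊛ f ≐ (λ n → a K.* f n)
  ⊛-constantˡ a f zero    = K.+-identityʳ _
  ⊛-constantˡ a f (suc n) = K.trans
    (K.+-congˡ (⊛-zeroˡ (tail (constant a)) f (λ _ → K.refl) n))
    (K.+-identityʳ _)

  ⊛-identityˡ : ∀ f → constant K.1# ⊛ f ≐ f
  ⊛-identityˡ f n = K.trans (⊛-constantˡ K.1# f n) (K.*-identityˡ _)

  constant-0 : ∀ n → constant K.0# n K.≈ K.0#
  constant-0 zero    = K.refl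
  constant-0 (suc n) = K.refl

  ⊕-identityˡ : ∀ f → constant K.0# ⊕ f ≐ f
  ⊕-identityˡ f n = K.trans (K.+-congʳ (constant-0 n)) (K.+-identityˡ _)

  ⊕-inverseˡ : ∀ f → (λ n → K.- f n) ⊕ f ≐ constant K.0#
  ⊕-inverseˡ f n = K.trans (K.-‿inverseˡ _) (K.sym (constant-0 n))

  ring : CommutativeRing c ℓ₁
  ring = record
    { Carrier = PS
    ; _≈_     = _≐_
    ; _+_     = _⊕_
    ; _*_     = _⊛_
    ; -_      = λ f n → K.- f n
    ; 0#      = constant K.0#
    ; 1#      = constant K.1#
    ; isCommutativeRing = record
      { isRing = record
        { +-isAbelianGroup = record
          { isGroup = record
            { isMonoid = record
              { isSemigroup = record
                { isMagma = record
                  { isEquivalence = record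
                    { refl  = λ _ → K.refl
                    ; sym   = λ p n → K.sym (p n)
                    ; trans = λ p q n → K.trans (p n) (q n)
                    }
                  ; ∙-cong = λ p q n → K.+-cong (p n) (q n)
                  }
                ; assoc = λ _ _ _ _ → K.+-assoc _ _ _
                }
              ; identity = ⊕-identityˡ ,
                  λ f n → K.trans (K.+-comm _ _) (⊕-identityˡ f n)
              }
            ; inverse = ⊕-inverseˡ ,
                λ f n → K.trans (K.+-comm _ _) (⊕-inverseˡ f n)
            ; ⁻¹-cong = λ p n → K.-‿cong (p n)
            }
          ; comm = λ _ _ _ → K.+-comm _ _
          }
        ; *-cong = ⊛-cong
        ; *-assoc = ⊛-assoc
        ; *-identity = ⊛-identityˡ ,
            λ f n → K.trans (⊛-comm f (constant K.1#) n) (⊛-identityˡ f n)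
        ; distrib =
            (λ f g h n → K.trans (⊛-comm f (g ⊕ h) n)
              (K.trans (⊛-distribʳ f g h n)
                (K.+-cong (⊛-comm g f n) (⊛-comm h f n)))) ,
            ⊛-distribʳ
        }
      ; *-comm = ⊛-comm
      }
    }

  -- The monomial t^m. In particular `T e` is the numerator of `z`.
  T : ℕ → PS
  T m = shift m (constant K.1#)

  -- Turns the shifts in the addition of Laurent series into ring products, which the semiring
  -- solver can handle.
  shift≐T⊛ : ∀ m f → shift m f ≐ T m ⊛ f
  shift≐T⊛ zero    f n       = K.sym (⊛-identityˡ f n)
  shift≐T⊛ (suc m) f zero    = K.sym (K.trans (K.+-identityʳ _) (K.zeroˡ _))
  shift≐T⊛ (suc m) f (suc n) = K.trans (shift≐T⊛ m f n)
    (K.sym (K.trans (K.+-congʳ (K.zeroˡ _)) (K.+-identityˡ _)))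

  shift-+ : ∀ m n f → shift (m ℕ.+ n) f ≐ shift m (shift n f)
  shift-+ zero    n f k       = K.refl
  shift-+ (suc m) n f zero    = K.refl
  shift-+ (suc m) n f (suc k) = shift-+ m n f k

  T-+ : ∀ m n → T (m ℕ.+ n) ≐ T m ⊛ T n
  T-+ m n k = K.trans (shift-+ m n _ k) (shift≐T⊛ m (T n) k)

-- Laurent series in t as a commutative ring, and power series inside it.

module Laurent {c ℓ₁ ℓ₂} (K : HeytingField c ℓ₁ ℓ₂) (e : ℕ) .{{_ : NonZero e}} where

  open Puiseux K e
  open PowerSeries K e using (PS; _≐_; T; shift≐T⊛; T-+)
  private
    module K = CommutativeRing
      (HeytingCommutativeRing.commutativeRing
        (HeytingField.heytingCommutativeRing K))
    module A = CommutativeRing (PowerSeries.ring K e)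
    module A-Properties = RingProperties A.ring
    module S = NaturalCoefficients A.commutativeSemiring
    module A-Reasoning = SetoidReasoning A.setoid

  at : PS → ℤ → K.Carrier
  at f (+ n)      = f n
  at f (-[1+ _ ]) = K.0#

  at-cong : ∀ {f g} → f ≐ g → ∀ k → at f k K.≈ at g k
  at-cong f≐g (+ n)      = f≐g n
  at-cong f≐g (-[1+ _ ]) = K.refl

  -- Trades the `with` inside `coeff` for a function applied to an exponent, so that the exponent
  -- can be rewritten.
  coeff≡at : ∀ x k → coeff x k ≡ at (num x) (k ℤ.+ + pole x)
  coeff≡at x k with k ℤ.+ + pole x
  ... | + _      = ≡.refl
  ... | -[1+ _ ] = ≡.refl

  at-shift-suc : ∀ m f k → at (shift (suc m) f) (ℤ.suc k) ≡ at (shift m f) k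
  at-shift-suc m f (+ n)          = ≡.refl
  -- Exponent -1 moves to index 0, where `shift` inserts `0#`.
  at-shift-suc m f (-[1+ zero ])  = ≡.refl
  at-shift-suc m f (-[1+ suc n ]) = ≡.refl

  at-shift : ∀ m f k → at (shift m f) (+ m ℤ.+ k) ≡ at f k
  at-shift zero    f k = ≡.cong (at f) (ℤ.+-identityˡ k)
  at-shift (suc m) f k = ≡.trans
    (≡.cong (at (shift (suc m) f)) (ℤ.+-assoc (+ 1) (+ m) k))
    (≡.trans (at-shift-suc m f (+ m ℤ.+ k)) (at-shift m f k))

  -- Enlarges the pole by `m`. With `m` the pole of a second series, both series are read off over
  -- the same common pole, which makes equality of coefficients and equality of shifted numerators
  -- interchangeable.
  coeff≡at-shift : ∀ x m k →
    coeff x k ≡ at (shift m (num x)) (+ (pole x ℕ.+ m) ℤ.+ k)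
  coeff≡at-shift x m k = ≡.trans (coeff≡at x k)
    (≡.trans (≡.sym (at-shift m (num x) (k ℤ.+ + pole x)))
      (≡.cong (at (shift m (num x))) (begin
        + m ℤ.+ (k ℤ.+ + pole x)  ≡⟨ ≡.cong (λ j → + m ℤ.+ j) (ℤ.+-comm k _) ⟩
        + m ℤ.+ (+ pole x ℤ.+ k)  ≡⟨ ℤ.+-assoc (+ m) (+ pole x) k ⟨
        + (m ℕ.+ pole x) ℤ.+ k    ≡⟨ ≡.cong (λ j → + j ℤ.+ k) (ℕ.+-comm m (pole x)) ⟩
        + (pole x ℕ.+ m) ℤ.+ k    ∎)))
    where open ≡.≡-Reasoning

  shift≐⇒≈ : ∀ x y → shift (pole y) (num x) ≐ shift (pole x) (num y) → x ≈ y
  shift≐⇒≈ x y eq k = K.trans (K.reflexive (coeff≡at-shift x (pole y) k))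
    (K.trans (at-cong eq (+ (pole x ℕ.+ pole y) ℤ.+ k)) (K.sym (K.reflexive (≡.trans
      (coeff≡at-shift y (pole x) k)
      (≡.cong (λ j → at (shift (pole x) (num y)) (+ j ℤ.+ k))
        (ℕ.+-comm (pole y) (pole x)))))))

  ≈⇒shift≐ : ∀ x y → x ≈ y → shift (pole y) (num x) ≐ shift (pole x) (num y)
  ≈⇒shift≐ x y x≈y n = begin
    shift (pole y) (num x) n
      ≡⟨ ≡.cong (at (shift (pole y) (num x))) (≡.sym m+k≡n) ⟩
    at (shift (pole y) (num x)) (+ m ℤ.+ k)
      ≡⟨ coeff≡at-shift x (pole y) k ⟨
    coeff x k
      ≈⟨ x≈y k ⟩
    coeff y k
      ≡⟨ coeff≡at-shift y (pole x) k ⟩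
    at (shift (pole x) (num y)) (+ (pole y ℕ.+ pole x) ℤ.+ k)
      ≡⟨ ≡.cong (λ j → at (shift (pole x) (num y)) (+ j ℤ.+ k))
           (ℕ.+-comm (pole y) (pole x)) ⟩
    at (shift (pole x) (num y)) (+ m ℤ.+ k)
      ≡⟨ ≡.cong (at (shift (pole x) (num y))) m+k≡n ⟩
    shift (pole x) (num y) n  ∎
    where
    open SetoidReasoning K.setoid
    m = pole x ℕ.+ pole y
    -- The exponent whose coefficient sits at index `n` over the common pole `m`.
    k = ℤ.- (+ m) ℤ.+ + n
    m+k≡n : + m ℤ.+ k ≡ + n
    m+k≡n = ≡.trans (≡.sym (ℤ.+-assoc (+ m) (ℤ.- (+ m)) (+ n)))
      (≡.trans (≡.cong (ℤ._+ + n) (ℤ.+-inverseʳ (+ m))) (ℤ.+-identityˡ (+ n)))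

  -- x = a / s, which turns the ring laws for Laurent series into identities
  -- between cross-multiplied numerators in the power series ring.
  record _≗_/_ (x : Series) (a s : PS) : Set ℓ₁ where
    constructor fraction
    field
      num≐    : num x ≐ a
      T-pole≐ : T (pole x) ≐ s

  fraction-refl : ∀ x → x ≗ num x / T (pole x)
  fraction-refl x = fraction A.refl A.refl

  fraction-0 : 0# ≗ A.0# / A.1#
  fraction-0 = fraction A.refl A.refl

  fraction-1 : 1# ≗ A.1# / A.1#
  fraction-1 = fraction A.refl A.refl

  module _ {x y : Series} {a b s r : PS} (p : x ≗ a / s) (q : y ≗ b / r) where

    private
      module p = _≗_/_ p
      module q = _≗_/_ q

    fraction-+ : (x + y) ≗ (r A.* a A.+ s A.* b) / (s A.* r)
    fraction-+ = fraction
      (A.+-cong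
        (A.trans (shift≐T⊛ (pole y) (num x)) (A.*-cong q.T-pole≐ p.num≐))
        (A.trans (shift≐T⊛ (pole x) (num y)) (A.*-cong p.T-pole≐ q.num≐)))
      (A.trans (T-+ (pole x) (pole y)) (A.*-cong p.T-pole≐ q.T-pole≐))

    fraction-* : (x * y) ≗ (a A.* b) / (s A.* r)
    fraction-* = fraction
      (A.*-cong p.num≐ q.num≐)
      (A.trans (T-+ (pole x) (pole y)) (A.*-cong p.T-pole≐ q.T-pole≐))

    fraction-≈ : r A.* a ≐ s A.* b → x ≈ y
    fraction-≈ eq = shift≐⇒≈ x y
      (A.trans (shift≐T⊛ (pole y) (num x))
        (A.trans (A.*-cong q.T-pole≐ p.num≐)
          (A.trans eq
            (A.sym (A.trans (shift≐T⊛ (pole x) (num y))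
              (A.*-cong p.T-pole≐ q.num≐))))))

  fraction-neg : ∀ {x a s} → x ≗ a / s → (- x) ≗ (A.- a) / s
  fraction-neg (fraction p q) = fraction (A.-‿cong p) q

  -- Converse to `fraction-≈` for the canonical fractions `fraction-refl`; this is how a hypothesis
  -- `x ≈ y` enters the congruence proofs.
  cross : ∀ x y → x ≈ y → T (pole y) A.* num x ≐ T (pole x) A.* num y
  cross x y x≈y = A.trans (A.sym (shift≐T⊛ (pole y) (num x)))
    (A.trans (≈⇒shift≐ x y x≈y) (shift≐T⊛ (pole x) (num y)))

  ≈-refl : ∀ {x} → x ≈ x
  ≈-refl k = K.refl

  ≈-sym : ∀ {x y} → x ≈ y → y ≈ x
  ≈-sym p k = K.sym (p k)

  ≈-trans : ∀ {x y w} → x ≈ y → y ≈ w → x ≈ w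
  ≈-trans p q k = K.trans (p k) (q k)

  private
    φ = fraction-refl

  +-cong : ∀ {x x′ y y′} → x ≈ x′ → y ≈ y′ → x + y ≈ x′ + y′
  +-cong {x} {x′} {y} {y′} p q =
    fraction-≈ (fraction-+ (φ x) (φ y)) (fraction-+ (φ x′) (φ y′)) (begin
      (s′ A.* r′) A.* (r A.* a A.+ s A.* b)
        -- Regrouped so that `s′ * a` and `r′ * b` appear, to which the cross-multiplied hypotheses
        -- apply.
        ≈⟨ S.solve 6 (λ a b s r s′ r′ →
             (s′ S.:* r′) S.:* (r S.:* a S.:+ s S.:* b)
             S.:= r S.:* r′ S.:* (s′ S.:* a) S.:+ s S.:* s′ S.:* (r′ S.:* b))
             A.refl a b s r s′ r′ ⟩
      r A.* r′ A.* (s′ A.* a) A.+ s A.* s′ A.* (r′ A.* b)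
        ≈⟨ A.+-cong (A.*-congˡ {r A.* r′} (cross x x′ p))
                   (A.*-congˡ {s A.* s′} (cross y y′ q)) ⟩
      r A.* r′ A.* (s A.* a′) A.+ s A.* s′ A.* (r A.* b′)
        ≈⟨ S.solve 6 (λ a b s r s′ r′ →
             r S.:* r′ S.:* (s S.:* a) S.:+ s S.:* s′ S.:* (r S.:* b)
             S.:= (s S.:* r) S.:* (r′ S.:* a S.:+ s′ S.:* b))
             A.refl a′ b′ s r s′ r′ ⟩
      (s A.* r) A.* (r′ A.* a′ A.+ s′ A.* b′)  ∎)
    where
    open A-Reasoning
    a = num x ; a′ = num x′ ; b = num y ; b′ = num y′
    s = T (pole x) ; s′ = T (pole x′) ; r = T (pole y) ; r′ = T (pole y′)

  *-cong : ∀ {x x′ y y′} → x ≈ x′ → y ≈ y′ → x * y ≈ x′ * y′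
  *-cong {x} {x′} {y} {y′} p q =
    fraction-≈ (fraction-* (φ x) (φ y)) (fraction-* (φ x′) (φ y′)) (begin
      (s′ A.* r′) A.* (a A.* b)    ≈⟨ interchange s′ r′ a b ⟩
      (s′ A.* a) A.* (r′ A.* b)    ≈⟨ A.*-cong (cross x x′ p) (cross y y′ q) ⟩
      (s A.* a′) A.* (r A.* b′)    ≈⟨ interchange s a′ r b′ ⟩
      (s A.* r) A.* (a′ A.* b′)    ∎)
    where
    open A-Reasoning
    interchange = S.solve 4 (λ a b d w →
      (a S.:* b) S.:* (d S.:* w) S.:= (a S.:* d) S.:* (b S.:* w)) A.refl
    a = num x ; a′ = num x′ ; b = num y ; b′ = num y′
    s = T (pole x) ; s′ = T (pole x′) ; r = T (pole y) ; r′ = T (pole y′)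

  -‿cong : ∀ {x y} → x ≈ y → - x ≈ - y
  -‿cong {x} {y} p =
    fraction-≈ (fraction-neg (φ x)) (fraction-neg (φ y))
      (A.trans (A.sym (A-Properties.-‿distribʳ-* (T (pole y)) (num x)))
        (A.trans (A.-‿cong (cross x y p))
          (A-Properties.-‿distribʳ-* (T (pole x)) (num y))))

  +-assoc : ∀ x y w → (x + y) + w ≈ x + (y + w)
  +-assoc x y w =
    fraction-≈ (fraction-+ (fraction-+ (φ x) (φ y)) (φ w))
               (fraction-+ (φ x) (fraction-+ (φ y) (φ w)))
      (S.solve 6 (λ a b d s r t →
        (s S.:* (r S.:* t)) S.:*
          (t S.:* (r S.:* a S.:+ s S.:* b) S.:+ (s S.:* r) S.:* d)
        S.:= ((s S.:* r) S.:* t) S.:*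
          ((r S.:* t) S.:* a S.:+ s S.:* (t S.:* b S.:+ r S.:* d)))
        A.refl (num x) (num y) (num w) (T (pole x)) (T (pole y)) (T (pole w)))

  +-comm : ∀ x y → x + y ≈ y + x
  +-comm x y =
    fraction-≈ (fraction-+ (φ x) (φ y)) (fraction-+ (φ y) (φ x))
      (S.solve 4 (λ a b s r →
        (r S.:* s) S.:* (r S.:* a S.:+ s S.:* b)
        S.:= (s S.:* r) S.:* (s S.:* b S.:+ r S.:* a))
        A.refl (num x) (num y) (T (pole x)) (T (pole y)))

  +-identityˡ : ∀ x → 0# + x ≈ x
  +-identityˡ x =
    fraction-≈ (fraction-+ fraction-0 (φ x)) (φ x)
      (S.solve 2 (λ a s →
        s S.:* (s S.:* S.con 0 S.:+ S.con 1 S.:* a)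
        S.:= (S.con 1 S.:* s) S.:* a) A.refl (num x) (T (pole x)))

  -‿inverseˡ : ∀ x → - x + x ≈ 0#
  -‿inverseˡ x =
    -- The solver works over semirings, so the cancellation of `a` against its negative is done by
    -- hand.
    fraction-≈ (fraction-+ (fraction-neg (φ x)) (φ x)) fraction-0 (begin
      A.1# A.* (s A.* (A.- a) A.+ s A.* a)  ≈⟨ A.*-identityˡ (s A.* (A.- a) A.+ s A.* a) ⟩
      s A.* (A.- a) A.+ s A.* a             ≈⟨ A.distribˡ s (A.- a) a ⟨
      s A.* (A.- a A.+ a)                   ≈⟨ A.*-congˡ {s} (A.-‿inverseˡ a) ⟩
      s A.* A.0#                            ≈⟨ A.zeroʳ s ⟩
      A.0#                                  ≈⟨ A.zeroʳ (s A.* s) ⟨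
      (s A.* s) A.* A.0#                    ∎)
    where
    open A-Reasoning
    a = num x
    s = T (pole x)

  *-assoc : ∀ x y w → (x * y) * w ≈ x * (y * w)
  *-assoc x y w =
    fraction-≈ (fraction-* (fraction-* (φ x) (φ y)) (φ w))
               (fraction-* (φ x) (fraction-* (φ y) (φ w)))
      (S.solve 6 (λ a b d s r t →
        (s S.:* (r S.:* t)) S.:* ((a S.:* b) S.:* d)
        S.:= ((s S.:* r) S.:* t) S.:* (a S.:* (b S.:* d)))
        A.refl (num x) (num y) (num w) (T (pole x)) (T (pole y)) (T (pole w)))

  *-comm : ∀ x y → x * y ≈ y * x
  *-comm x y =
    fraction-≈ (fraction-* (φ x) (φ y)) (fraction-* (φ y) (φ x))
      (S.solve 4 (λ a b s r →
        (r S.:* s) S.:* (a S.:* b) S.:= (s S.:* r) S.:* (b S.:* a))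
        A.refl (num x) (num y) (T (pole x)) (T (pole y)))

  *-identityˡ : ∀ x → 1# * x ≈ x
  *-identityˡ x =
    fraction-≈ (fraction-* fraction-1 (φ x)) (φ x)
      (S.solve 2 (λ a s →
        s S.:* (S.con 1 S.:* a) S.:= (S.con 1 S.:* s) S.:* a)
        A.refl (num x) (T (pole x)))

  *-distribʳ : ∀ x y w → (y + w) * x ≈ y * x + w * x
  *-distribʳ x y w =
    fraction-≈ (fraction-* (fraction-+ (φ y) (φ w)) (φ x))
               (fraction-+ (fraction-* (φ y) (φ x)) (fraction-* (φ w) (φ x)))
      (S.solve 6 (λ a b d s r t →
        ((r S.:* s) S.:* (t S.:* s)) S.:* ((t S.:* b S.:+ r S.:* d) S.:* a)
        S.:= ((r S.:* t) S.:* s) S.:*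
          ((t S.:* s) S.:* (b S.:* a) S.:+ (r S.:* s) S.:* (d S.:* a)))
        A.refl (num x) (num y) (num w) (T (pole x)) (T (pole y)) (T (pole w)))

  ring : CommutativeRing c ℓ₁
  ring = record
    { Carrier = Series
    ; _≈_     = _≈_
    ; _+_     = _+_
    ; _*_     = _*_
    ; -_      = -_
    ; 0#      = 0#
    ; 1#      = 1#
    ; isCommutativeRing = record
      { isRing = record
        { +-isAbelianGroup = record
          { isGroup = record
            { isMonoid = record
              { isSemigroup = record
                { isMagma = record
                  { isEquivalence = record
                    { refl  = λ {x} → ≈-refl {x}
                    ; sym   = λ {x} {y} → ≈-sym {x} {y}
                    ; trans = λ {x} {y} {w} → ≈-trans {x} {y} {w}
                    }
                  ; ∙-cong = λ {x} {x′} {y} {y′} → +-cong {x} {x′} {y} {y′}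
                  }
                ; assoc = +-assoc
                }
              ; identity = +-identityˡ ,
                  λ x → ≈-trans {x + 0#} (+-comm x 0#) (+-identityˡ x)
              }
            ; inverse = -‿inverseˡ ,
                λ x → ≈-trans {x - x} (+-comm x (- x)) (-‿inverseˡ x)
            ; ⁻¹-cong = λ {x} {y} → -‿cong {x} {y}
            }
          ; comm = +-comm
          }
        ; *-cong = λ {x} {x′} {y} {y′} → *-cong {x} {x′} {y} {y′}
        ; *-assoc = *-assoc
        ; *-identity = *-identityˡ ,
            λ x → ≈-trans {x * 1#} (*-comm x 1#) (*-identityˡ x)
        ; distrib =
            (λ x y w → ≈-trans {x * (y + w)} (*-comm x (y + w))
              (≈-trans {(y + w) * x} (*-distribʳ x y w)
                (+-cong {y * x} {x * y} {w * x} (*-comm y x) (*-comm w x)))) ,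
            *-distribʳ
        }
      ; *-comm = *-comm
      }
    }

  z⁻¹ : Series
  z⁻¹ = e , constant K.1#

  z⁻¹*z≈1 : z⁻¹ * z ≈ 1#
  z⁻¹*z≈1 = fraction-≈ (fraction-* (φ z⁻¹) (φ z)) fraction-1
    (S.solve 1 (λ t → S.con 1 S.:* (S.con 1 S.:* t)
       S.:= (t S.:* S.con 1) S.:* S.con 1) A.refl (T e))

  embed : PS → Series
  embed f = 0 , f

  embed-cong : ∀ {f g} → f ≐ g → embed f ≈ embed g
  embed-cong f≐g = shift≐⇒≈ _ _ f≐g

  embed-injective : ∀ {f g} → embed f ≈ embed g → f ≐ g
  embed-injective p = ≈⇒shift≐ _ _ p

  -- All coefficients at negative exponents vanish, so dropping the first `pole u` entries of the
  -- numerator loses nothing. A small root is thus a power series.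
  tendsToZero⇒embed : ∀ u → TendsToZero u → u ≈ embed (λ n → num u (n ℕ.+ pole u))
  tendsToZero⇒embed u u→0 (+ n) = K.reflexive
    (≡.cong (λ m → num u (m ℕ.+ pole u)) (≡.sym (ℕ.+-identityʳ n)))
  tendsToZero⇒embed u u→0 (-[1+ n ]) = u→0 -[1+ n ] ℤ.-≤+

-- Counting walks by their first jump.

length-filter-map : ∀ {a b p q} {A : Set a} {B : Set b} {P : Pred B p} {Q : Pred A q}
  (P? : Decidable P) (Q? : Decidable Q) (f : A → B) →
  (∀ x → P (f x) → Q x) → (∀ x → Q x → P (f x)) →
  ∀ xs → length (filter P? (map f xs)) ≡ length (filter Q? xs)
length-filter-map P? Q? f to from []       = ≡.refl
length-filter-map P? Q? f to from (x ∷ xs) with P? (f x) | Q? x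
... | yes _ | yes _ = ≡.cong suc (length-filter-map P? Q? f to from xs)
... | no  _ | no  _ = length-filter-map P? Q? f to from xs
... | yes p | no ¬q = contradiction (to x p) ¬q
... | no ¬p | yes q = contradiction (from x q) ¬p

private
  splitWalks : ∀ a b n → numWalks a b (suc n) ≡
    length (filter (isWalk? a b) (map (down Vec.∷_) (jumpSequences n))) ℕ.+
    length (filter (isWalk? a b) (map (up Vec.∷_) (jumpSequences n)))
  splitWalks a b n = ≡.trans
    (≡.cong length (filter-++ (isWalk? a b) downs (map (up Vec.∷_) (jumpSequences n))))
    (length-++ (filter (isWalk? a b) downs))
    where downs = map (down Vec.∷_) (jumpSequences n)

-- Once `0 ≤ a` is known, `j ∷ js` is a walk from `a` exactly when `js` is a walk from `a + size j`,
-- so the two halves of `jumpSequences` are counted separately.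
numWalks-suc : ∀ {a} → 0ℤ ℤ.≤ a → ∀ b n → numWalks a b (suc n) ≡
  numWalks (a ℤ.+ size down) b n ℕ.+ numWalks (a ℤ.+ size up) b n
numWalks-suc {a} 0≤a b n = ≡.trans (splitWalks a b n)
  (≡.cong₂ ℕ._+_ (firstJump down) (firstJump up))
  where
  firstJump : ∀ j →
    length (filter (isWalk? a b) (map (j Vec.∷_) (jumpSequences n))) ≡
    numWalks (a ℤ.+ size j) b n
  firstJump j = length-filter-map (isWalk? a b) (isWalk? (a ℤ.+ size j) b)
    (j Vec.∷_) (λ _ → proj₂) (λ _ w → 0≤a , w) (jumpSequences n)

-- The starting altitude already violates the constraint: its decision evaluates to `no`, and
-- `filter` discards every sequence. This removes the down term at altitudes 0 and 1.
numWalks-negative : ∀ k b n → numWalks -[1+ k ] b n ≡ 0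
numWalks-negative k b zero    = ≡.refl
numWalks-negative k b (suc n) = ≡.trans (splitWalks -[1+ k ] b n)
  (≡.cong₂ ℕ._+_ (noWalk down (jumpSequences n)) (noWalk up (jumpSequences n)))
  where
  noWalk : ∀ j (jss : List (Vec Jump n)) →
    length (filter (isWalk? -[1+ k ] b) (map (j Vec.∷_) jss)) ≡ 0
  noWalk j []         = ≡.refl
  noWalk j (js ∷ jss) = noWalk j jss

numWalks-2+ : ∀ a b n → numWalks (+ (2 ℕ.+ a)) b (suc n) ≡
  numWalks (+ a) b n ℕ.+ numWalks (+ (7 ℕ.+ a)) b n
numWalks-2+ a b n = ≡.trans (numWalks-suc (ℤ.+≤+ ℕ.z≤n) b n)
  -- The altitude after a down jump evaluates to `a`; the one after an up jump evaluates to
  -- `2 + (a + 5)` and has to be brought to `7 + a`.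
  (≡.cong (λ c → numWalks (+ a) b n ℕ.+ numWalks (+ (2 ℕ.+ c)) b n) (ℕ.+-comm a 5))

numWalks-0 : ∀ b n → numWalks (+ 0) b (suc n) ≡ numWalks (+ 5) b n
numWalks-0 b n = ≡.trans (numWalks-suc (ℤ.+≤+ ℕ.z≤n) b n)
  -- The argument 1 stands for altitude -2, which is `-[1+ 1 ]`.
  (≡.cong (ℕ._+ numWalks (+ 5) b n) (numWalks-negative 1 b n))

numWalks-1 : ∀ b n → numWalks (+ 1) b (suc n) ≡ numWalks (+ 6) b n
numWalks-1 b n = ≡.trans (numWalks-suc (ℤ.+≤+ ℕ.z≤n) b n)
  (≡.cong (ℕ._+ numWalks (+ 6) b n) (numWalks-negative 0 b n))

-- The kernel equation for power series roots, modulo growing powers of t.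

module Kernel {c ℓ₁ ℓ₂} (K : HeytingField c ℓ₁ ℓ₂) (e : ℕ) .{{_ : NonZero e}} where

  open Puiseux K e using (num; shift; constant; generatingFunction)
  open PowerSeries K e using (PS; _≐_; T; shift≐T⊛)
  private
    module K = CommutativeRing
      (HeytingCommutativeRing.commutativeRing
        (HeytingField.heytingCommutativeRing K))
    module A = CommutativeRing (PowerSeries.ring K e)
    module S = NaturalCoefficients A.commutativeSemiring
    module A-Reasoning = SetoidReasoning A.setoid
    module K× = MonoidMult K.+-monoid
  open SemiringExp A.semiring using (_^_)

  gf : (ℕ → ℕ) → PS
  gf f = num (generatingFunction f)

  gf-cong : ∀ {f g} → (∀ n → f n ≡ g n) → gf f ≐ gf g
  gf-cong eq n with e ∣? n
  ... | yes (divides q _) = K×.×-congˡ (eq q)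
  ... | no  _             = K.refl

  gf-+ : ∀ f g → gf (λ n → f n ℕ.+ g n) ≐ gf f A.+ gf g
  gf-+ f g n with e ∣? n
  ... | yes (divides q _) = K×.×-homo-+ K.1# (f q) (g q)
  ... | no  _             = K.sym (K.+-identityˡ K.0#)

  gf-* : ∀ f q → gf f (q ℕ.* e) K.≈ f q K×.× K.1#
  gf-* f q with e ∣? (q ℕ.* e)
  -- The quotient found by the decision procedure must be `q`, since `e` is nonzero and cancels.
  ... | yes (divides r eq) = K×.×-congˡ (≡.cong f (ℕ.*-cancelʳ-≡ r q e (≡.sym eq)))
  ... | no ¬∣              = contradiction (divides-refl q) ¬∣

  gf-∤ : ∀ f n → ¬ e ∣ n → gf f n K.≈ K.0#
  gf-∤ f n ¬∣ with e ∣? n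
  ... | yes ∣n = contradiction ∣n ¬∣
  ... | no  _  = K.refl

  shift-< : ∀ {m n} f → n ℕ.< m → shift m f n ≡ K.0#
  shift-< {suc m} {zero}  f _   = ≡.refl
  shift-< {suc m} {suc n} f n<m = shift-< f (ℕ.s<s⁻¹ n<m)

  shift-≥ : ∀ m n f → shift m f (m ℕ.+ n) ≡ f n
  shift-≥ zero    n f = ≡.refl
  shift-≥ (suc m) n f = shift-≥ m n f

  constant-nonZero : ∀ a n .{{_ : NonZero n}} → constant a n ≡ K.0#
  constant-nonZero a (suc n) = ≡.refl

  -- Below index `e` only 0 is a multiple of `e`, which leaves the constant term. From `e` on,
  -- `e + n` is a multiple of `e` exactly when `n` is, with quotient one larger.
  gf-unfold : ∀ f → gf f ≐ constant (f 0 K×.× K.1#) A.+ T e A.* gf (f ∘ suc)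
  gf-unfold f = A.trans pointwise (A.+-congˡ (shift≐T⊛ e (gf (f ∘ suc))))
    where
    open SetoidReasoning K.setoid
    below : ∀ n → n ℕ.< e → gf f n K.≈ constant (f 0 K×.× K.1#) n
    below zero    n<e = gf-* f 0
    below (suc n) n<e = gf-∤ f (suc n) (>⇒∤ n<e)
    above : ∀ n → gf f (e ℕ.+ n) K.≈ gf (f ∘ suc) n
    above n with e ∣? n
    ... | yes (divides-refl q) = gf-* f (suc q)
    ... | no ¬∣ = gf-∤ f (e ℕ.+ n) (λ e∣e+n → ¬∣ (∣m+n∣m⇒∣n e∣e+n ∣-refl))
    instance
      e+n≢0 : ∀ {n} → NonZero (e ℕ.+ n)
      e+n≢0 {n} = ℕ.>-nonZero (ℕ.≤-trans (ℕ.>-nonZero⁻¹ e) (ℕ.m≤m+n e n))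
    pointwise : gf f ≐ constant (f 0 K×.× K.1#) A.+ shift e (gf (f ∘ suc))
    pointwise n with ℕ.<-≤-connex n e
    ... | inj₁ n<e = begin
      gf f n                                         ≈⟨ below n n<e ⟩
      constant (f 0 K×.× K.1#) n                     ≈⟨ K.+-identityʳ _ ⟨
      constant (f 0 K×.× K.1#) n K.+ K.0#
        ≡⟨ ≡.cong (constant (f 0 K×.× K.1#) n K.+_) (shift-< (gf (f ∘ suc)) n<e) ⟨
      constant (f 0 K×.× K.1#) n K.+ shift e (gf (f ∘ suc)) n  ∎
    ... | inj₂ e≤n with ℕ.m≤n⇒∃[o]m+o≡n e≤n
    ...   | m , ≡.refl = begin
      gf f (e ℕ.+ m)                                 ≈⟨ above m ⟩
      gf (f ∘ suc) m                                 ≈⟨ K.+-identityˡ _ ⟨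
      K.0# K.+ gf (f ∘ suc) m
        ≡⟨ ≡.cong₂ K._+_ (constant-nonZero (f 0 K×.× K.1#) (e ℕ.+ m))
             (shift-≥ e m (gf (f ∘ suc))) ⟨
      constant (f 0 K×.× K.1#) (e ℕ.+ m) K.+ shift e (gf (f ∘ suc)) (e ℕ.+ m)  ∎

  walks : ℕ → ℕ → PS
  walks a b = gf (numWalks (+ a) (+ b))

  constant≐ : ∀ {x y} → x K.≈ y → constant x ≐ constant y
  constant≐ x≈y zero    = x≈y
  constant≐ x≈y (suc n) = K.refl

  private
    unfold : ∀ a b f → (∀ n → numWalks (+ a) (+ b) (suc n) ≡ f n) → ∀ {x} →
      numWalks (+ a) (+ b) 0 K×.× K.1# K.≈ x →
      walks a b ≐ constant x A.+ T e A.* gf f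
    unfold a b f eq {x} init = A.trans (gf-unfold (numWalks (+ a) (+ b)))
      (A.+-cong (constant≐ init) (A.*-congˡ {T e} (gf-cong eq)))

  infix 4 _≈[_]_
  -- Congruence modulo t^m.
  _≈[_]_ : PS → ℕ → PS → Set ℓ₁
  f ≈[ m ] g = ∀ n → n ℕ.< m → f n K.≈ g n

  -- Multiplication by z moves coefficients up by `e` places, and `e ≥ 1`, so at least one more
  -- coefficient agrees.
  contract : ∀ m f g → f ≈[ m ] g → (T e A.* f) ≈[ suc m ] (T e A.* g)
  contract m f g p n n<1+m = begin
    (T e A.* f) n  ≈⟨ shift≐T⊛ e f n ⟨
    shift e f n    ≈⟨ contract-shift ⟩
    shift e g n    ≈⟨ shift≐T⊛ e g n ⟩
    (T e A.* g) n  ∎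
    where
    open SetoidReasoning K.setoid
    contract-shift : shift e f n K.≈ shift e g n
    contract-shift with ℕ.<-≤-connex n e
    ... | inj₁ n<e = K.reflexive (≡.trans (shift-< f n<e) (≡.sym (shift-< g n<e)))
    ... | inj₂ e≤n with ℕ.m≤n⇒∃[o]m+o≡n e≤n
    ...   | k , ≡.refl = begin
      shift e f (e ℕ.+ k)  ≡⟨ shift-≥ e k f ⟩
      -- From `e + k < 1 + m` and `1 ≤ e` follows `1 + k ≤ e + k ≤ m`.
      f k                  ≈⟨ p k (ℕ.≤-trans (ℕ.+-monoˡ-≤ k (ℕ.>-nonZero⁻¹ e)) (ℕ.s≤s⁻¹ n<1+m)) ⟩
      g k                  ≡⟨ shift-≥ e k g ⟨
      shift e g (e ℕ.+ k)  ∎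

  module _ (g : PS) (root : g ^ 2 ≐ T e A.* (A.1# A.+ g ^ 7)) where

    kernelSide : ℕ → PS
    kernelSide a = T e A.* (walks a 0 A.+ g A.* walks a 1)

    power-step : ∀ a → g ^ (2 ℕ.+ a) ≐ T e A.* (g ^ a A.+ g ^ (7 ℕ.+ a))
    power-step a = begin
      g ^ (2 ℕ.+ a)
        ≈⟨ S.solve 2 (λ g h → g S.:* (g S.:* h) S.:= g S.:^ 2 S.:* h)
             A.refl g (g ^ a) ⟩
      g ^ 2 A.* g ^ a
        ≈⟨ A.*-congʳ {g ^ a} root ⟩
      T e A.* (A.1# A.+ g ^ 7) A.* g ^ a
        -- The nested product is what `g ^ (7 + a)` evaluates to, with `g ^ a` treated as an atom
        -- because `a` is a variable.
        ≈⟨ S.solve 3 (λ t g h → t S.:* (S.con 1 S.:+ g S.:^ 7) S.:* h S.:=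
             t S.:* (h S.:+ g S.:* (g S.:* (g S.:* (g S.:* (g S.:* (g S.:* (g S.:* h))))))))
             A.refl (T e) g (g ^ a) ⟩
      T e A.* (g ^ a A.+ g ^ (7 ℕ.+ a))  ∎
      where open A-Reasoning

    -- No down jump is possible from 0. The empty walk from 0 to 0 contributes the 1 that plays the
    -- part of `g ^ 0` in the recursion for powers.
    kernelSide-0 : kernelSide 0 ≐ T e A.* (A.1# A.+ kernelSide 5)
    kernelSide-0 = A.trans
      (A.*-congˡ {T e} (A.+-cong
        (unfold 0 0 _ (numWalks-0 (+ 0)) (K.+-identityʳ K.1#))
        (A.*-congˡ {g} (unfold 0 1 _ (numWalks-0 (+ 1)) K.refl))))
      (S.solve 4 (λ t g h k →
        t S.:* ((S.con 1 S.:+ t S.:* h) S.:+ g S.:* (S.con 0 S.:+ t S.:* k))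
        S.:= t S.:* (S.con 1 S.:+ t S.:* (h S.:+ g S.:* k)))
        A.refl (T e) g (walks 5 0) (walks 5 1))

    -- Here the empty walk from 1 to 1 contributes 1 to `walks 1 1`. The weight `g` in `kernelSide`
    -- turns it into the `g ^ 1` required by `power-step 1`.
    kernelSide-1 : kernelSide 1 ≐ T e A.* (g ^ 1 A.+ kernelSide 6)
    kernelSide-1 = A.trans
      (A.*-congˡ {T e} (A.+-cong
        (unfold 1 0 _ (numWalks-1 (+ 0)) K.refl)
        (A.*-congˡ {g} (unfold 1 1 _ (numWalks-1 (+ 1)) (K.+-identityʳ K.1#)))))
      (S.solve 4 (λ t g h k →
        t S.:* ((S.con 0 S.:+ t S.:* h) S.:+ g S.:* (S.con 1 S.:+ t S.:* k))
        S.:= t S.:* (g S.:^ 1 S.:+ t S.:* (h S.:+ g S.:* k)))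
        A.refl (T e) g (walks 6 0) (walks 6 1))

    kernelSide-2+ : ∀ a → kernelSide (2 ℕ.+ a) ≐
      T e A.* (kernelSide a A.+ kernelSide (7 ℕ.+ a))
    kernelSide-2+ a = A.trans
      -- Both uses of `K.refl` record a zero constant term: the empty walk from `2 + a` ends neither
      -- at 0 nor at 1.
      (A.*-congˡ {T e} (A.+-cong (step 0 K.refl) (A.*-congˡ {g} (step 1 K.refl))))
      (S.solve 6 (λ t g h k h′ k′ →
        t S.:* ((S.con 0 S.:+ t S.:* (h S.:+ h′)) S.:+
          g S.:* (S.con 0 S.:+ t S.:* (k S.:+ k′)))
        S.:= t S.:* (t S.:* (h S.:+ g S.:* k) S.:+ t S.:* (h′ S.:+ g S.:* k′)))
        A.refl (T e) g (walks a 0) (walks a 1)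
        (walks (7 ℕ.+ a) 0) (walks (7 ℕ.+ a) 1))
      where
      step : ∀ b → numWalks (+ (2 ℕ.+ a)) (+ b) 0 K×.× K.1# K.≈ K.0# →
        walks (2 ℕ.+ a) b ≐ A.0# A.+ T e A.* (walks a b A.+ walks (7 ℕ.+ a) b)
      step b init = A.trans (unfold (2 ℕ.+ a) b _ (numWalks-2+ a (+ b)) init)
        (A.+-congˡ {A.0#} (A.*-congˡ {T e}
          (gf-+ (numWalks (+ a) (+ b)) (numWalks (+ (7 ℕ.+ a)) (+ b)))))

    private
      via-contract : ∀ {f g m} x y → f ≐ T e A.* x → g ≐ T e A.* y →
        x ≈[ m ] y → f ≈[ suc m ] g
      via-contract {m = m} x y p q x≈y n n<1+m =
        K.trans (p n) (K.trans (contract m x y x≈y n n<1+m) (K.sym (q n)))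

    -- Induction on the precision `m`, for all altitudes at once, because an up jump raises the
    -- altitude. Both sides obey the same recursion with a factor z in front, and `contract`
    -- supplies the extra coefficient. For `m = 0` there is no index to check.
    kernel-below : ∀ m a → (g ^ (2 ℕ.+ a)) ≈[ m ] kernelSide a
    kernel-below (suc m) 0 =
      via-contract (A.1# A.+ g ^ 7) (A.1# A.+ kernelSide 5) root kernelSide-0
        (λ n n<m → K.+-congˡ (kernel-below m 5 n n<m))
    kernel-below (suc m) 1 =
      via-contract (g ^ 1 A.+ g ^ 8) (g ^ 1 A.+ kernelSide 6)
        (power-step 1) kernelSide-1
        (λ n n<m → K.+-congˡ (kernel-below m 6 n n<m))
    kernel-below (suc m) (suc (suc a)) =
      via-contract (g ^ (2 ℕ.+ a) A.+ g ^ (9 ℕ.+ a))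
        (kernelSide a A.+ kernelSide (7 ℕ.+ a))
        (power-step (2 ℕ.+ a)) (kernelSide-2+ a)
        (λ n n<m → K.+-cong (kernel-below m a n n<m)
                            (kernel-below m (7 ℕ.+ a) n n<m))

    kernel : ∀ a → g ^ (2 ℕ.+ a) ≐ kernelSide a
    -- Coefficient `n` is already fixed at precision `suc n`.
    kernel a n = kernel-below (suc n) a n ℕ.≤-refl

-- Algebra in an arbitrary commutative ring: clearing denominators and solving the linear systems.

module Elimination {c ℓ} (R : CommutativeRing c ℓ) where

  open CommutativeRing R
  open SemiringExp semiring using (_^_)
  open GroupProperties +-group
    using (inverseˡ-unique; identityˡ-unique; x∙y⁻¹≈ε⇒x≈y)
  open SetoidReasoning setoid
  private
    module S = NaturalCoefficients commutativeSemiring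

  -- Multiply `1 = z (v^2 + u^5)` by `u^2` and use `u v = 1` twice.
  root⇒u²≈z[1+u⁷] : ∀ z u v → u * v ≈ 1# → 1# - z * (v ^ 2 + u ^ 5) ≈ 0# →
    u ^ 2 ≈ z * (1# + u ^ 7)
  root⇒u²≈z[1+u⁷] z u v uv≈1 root = begin
    u ^ 2                             ≈⟨ *-identityʳ (u ^ 2) ⟨
    u ^ 2 * 1#                        ≈⟨ *-congˡ (x∙y⁻¹≈ε⇒x≈y _ _ root) ⟩
    u ^ 2 * (z * (v ^ 2 + u ^ 5))
      ≈⟨ S.solve 3 (λ z u v → u S.:^ 2 S.:* (z S.:* (v S.:^ 2 S.:+ u S.:^ 5))
           S.:= z S.:* ((u S.:* v) S.:* (u S.:* v) S.:+ u S.:^ 7)) refl z u v ⟩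
    z * ((u * v) * (u * v) + u ^ 7)
      ≈⟨ *-congˡ (+-congʳ (trans (*-cong uv≈1 uv≈1) (*-identityˡ 1#))) ⟩
    z * (1# + u ^ 7)                  ∎

  x-y+y≈x : ∀ x y → (x - y) + y ≈ x
  x-y+y≈x x y = trans (+-assoc x (- y) y)
    (trans (+-congˡ (-‿inverseˡ y)) (+-identityʳ x))

  x+y≈w⇒x≈w-y : ∀ x y w → x + y ≈ w → x ≈ w - y
  x+y≈w⇒x≈w-y x y w eq = begin
    x               ≈⟨ +-identityʳ x ⟨
    x + 0#          ≈⟨ +-congˡ (-‿inverseʳ y) ⟨
    x + (y - y)     ≈⟨ +-assoc x y (- y) ⟨
    x + y - y       ≈⟨ +-congʳ eq ⟩
    w - y           ∎

  -- Substituting u₁ = d + u₂ turns both eliminations into semiring identities.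
  eliminate-G : ∀ z u₁ u₂ F G {s₁ s₂} →
    s₁ ≈ z * (F + u₁ * G) → s₂ ≈ z * (F + u₂ * G) →
    G * (z * (u₁ - u₂)) ≈ s₁ - s₂
  eliminate-G z u₁ u₂ F G {s₁} {s₂} eq₁ eq₂ = x+y≈w⇒x≈w-y _ _ _ (begin
    G * (z * d) + s₂                   ≈⟨ +-congˡ eq₂ ⟩
    G * (z * d) + z * (F + u₂ * G)
      ≈⟨ S.solve 5 (λ z d u F G →
           G S.:* (z S.:* d) S.:+ z S.:* (F S.:+ u S.:* G)
           S.:= z S.:* (F S.:+ (d S.:+ u) S.:* G)) refl z d u₂ F G ⟩
    z * (F + (d + u₂) * G)
      ≈⟨ *-congˡ (+-congˡ (*-congʳ (x-y+y≈x u₁ u₂))) ⟩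
    z * (F + u₁ * G)                   ≈⟨ eq₁ ⟨
    s₁                                 ∎)
    where d = u₁ - u₂

  eliminate-F : ∀ z u₁ u₂ F G →
    u₁ ^ 5 ≈ z * (F + u₁ * G) → u₂ ^ 5 ≈ z * (F + u₂ * G) →
    F * (z * (u₁ - u₂)) ≈ - (u₁ * u₂ * (u₁ ^ 4 - u₂ ^ 4))
  eliminate-F z u₁ u₂ F G eq₁ eq₂ =
    -- The negated right side is moved to the left, and the sum is shown to vanish by adding
    -- `u₁ * u₂ ^ 5` and getting it back. This summand is chosen because it completes `w` to
    -- `u₁ ^ 4`.
    inverseˡ-unique _ _ (identityˡ-unique _ (u₁ * u₂ ^ 5) (begin
      F * (z * d) + u₁ * u₂ * w + u₁ * u₂ ^ 5
        ≈⟨ S.solve 4 (λ x u v w → x S.:+ u S.:* v S.:* w S.:+ u S.:* v S.:^ 5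
             S.:= x S.:+ u S.:* v S.:* (w S.:+ v S.:^ 4))
             refl (F * (z * d)) u₁ u₂ w ⟩
      F * (z * d) + u₁ * u₂ * (w + u₂ ^ 4)
        ≈⟨ +-congˡ (*-congˡ (x-y+y≈x (u₁ ^ 4) (u₂ ^ 4))) ⟩
      F * (z * d) + u₁ * u₂ * u₁ ^ 4
        ≈⟨ S.solve 3 (λ x u v → x S.:+ u S.:* v S.:* u S.:^ 4
             S.:= x S.:+ v S.:* u S.:^ 5) refl (F * (z * d)) u₁ u₂ ⟩
      F * (z * d) + u₂ * u₁ ^ 5
        ≈⟨ +-congˡ (*-congˡ eq₁) ⟩
      F * (z * d) + u₂ * (z * (F + u₁ * G))
        ≈⟨ +-congˡ (*-congˡ (*-congˡ (+-congˡ (*-congʳ (x-y+y≈x u₁ u₂))))) ⟨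
      F * (z * d) + u₂ * (z * (F + (d + u₂) * G))
        -- `G` drops out because `u₂ * u₁ ^ 5` and `u₁ * u₂ ^ 5` contain it in the same term,
        -- `z * u₁ * u₂ * G`.
        ≈⟨ S.solve 5 (λ z d u F G →
             F S.:* (z S.:* d) S.:+ u S.:* (z S.:* (F S.:+ (d S.:+ u) S.:* G))
             S.:= (d S.:+ u) S.:* (z S.:* (F S.:+ u S.:* G))) refl z d u₂ F G ⟩
      (d + u₂) * (z * (F + u₂ * G))
        ≈⟨ *-cong (x-y+y≈x u₁ u₂) (sym eq₂) ⟩
      u₁ * u₂ ^ 5  ∎))
    where
    d = u₁ - u₂
    w = u₁ ^ 4 - u₂ ^ 4

  -- Its contrapositive shows that the denominator `z * (u₁ - u₂)` is nonzero for distinct roots.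
  unit*[x-y]≈0⇒x≈y : ∀ z⁻¹ z x y → z⁻¹ * z ≈ 1# → z * (x - y) ≈ 0# → x ≈ y
  unit*[x-y]≈0⇒x≈y z⁻¹ z x y inv eq = x∙y⁻¹≈ε⇒x≈y x y (begin
    x - y                ≈⟨ *-identityˡ (x - y) ⟨
    1# * (x - y)         ≈⟨ *-congʳ inv ⟨
    z⁻¹ * z * (x - y)    ≈⟨ *-assoc z⁻¹ z (x - y) ⟩
    z⁻¹ * (z * (x - y))  ≈⟨ *-congˡ eq ⟩
    z⁻¹ * 0#             ≈⟨ zeroʳ z⁻¹ ⟩
    0#                   ∎)

-- The kernel equation for small roots as Laurent series, and the two closed forms.

module SmallRoots {c ℓ₁ ℓ₂} (K : HeytingField c ℓ₁ ℓ₂) (e : ℕ) .{{_ : NonZero e}} where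

  open Puiseux K e
  open Laurent K e using (embed; embed-cong; embed-injective; tendsToZero⇒embed)
  open PowerSeries K e using (PS; _≐_; T)
  private
    module A = CommutativeRing (PowerSeries.ring K e)
    module L = CommutativeRing (Laurent.ring K e)
    module A^ = SemiringExp A.semiring
    module L^ = SemiringExp L.semiring
    open Elimination (Laurent.ring K e)
    open SetoidReasoning L.setoid

  -- The root is replaced by the power series `g` equal to it, `kernel` is applied to `g`, and the
  -- result is carried back along `u≈g`.
  kernelEquation : ∀ u → IsSmallRoot u → ∀ a → u ^ (2 ℕ.+ a) ≈
    z * (generatingFunction (numWalks (+ a) (+ 0)) +
         u * generatingFunction (numWalks (+ a) (+ 1)))
  kernelEquation u ((v , uv≈1 , root) , u→0) a = begin
    u ^ (2 ℕ.+ a)              ≈⟨ L^.^-congˡ (2 ℕ.+ a) {u} {embed g} u≈g ⟩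
    embed g ^ (2 ℕ.+ a)        ≈⟨ embed-^ (2 ℕ.+ a) ⟩
    embed (g A^.^ (2 ℕ.+ a))   ≈⟨ embed-cong (Kernel.kernel K e g g-root a) ⟩
    -- All poles are 0, so `embed` of `kernelSide a` is this expression by computation.
    z * (H 0 + embed g * H 1)
      ≈⟨ L.*-congˡ {z} (L.+-congˡ {H 0} (L.*-congʳ {H 1} {u} {embed g} u≈g)) ⟨
    z * (H 0 + u * H 1)        ∎
    where
    H : ℕ → Series
    H b = generatingFunction (numWalks (+ a) (+ b))
    g : PS
    g n = num u (n ℕ.+ pole u)
    u≈g : u ≈ embed g
    u≈g = tendsToZero⇒embed u u→0
    embed-^ : ∀ n → embed g ^ n ≈ embed (g A^.^ n)
    embed-^ zero    = L.refl {1#}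
    embed-^ (suc n) = L.*-congˡ {embed g} {embed g ^ n} {embed (g A^.^ n)} (embed-^ n)
    -- The cleared equation is derived among Laurent series, where `u` has an inverse, and descends
    -- to power series since `embed` is injective.
    g-root : g A^.^ 2 ≐ T e A.* (A.1# A.+ g A^.^ 7)
    g-root = embed-injective {g A^.^ 2} {T e A.* (A.1# A.+ g A^.^ 7)} (begin
      embed g ^ 2              ≈⟨ L^.^-congˡ 2 {u} {embed g} u≈g ⟨
      u ^ 2                    ≈⟨ root⇒u²≈z[1+u⁷] z u v uv≈1 root ⟩
      z * (1# + u ^ 7)
        ≈⟨ L.*-congˡ {z} (L.+-congˡ {1#} (L^.^-congˡ 7 {u} {embed g} u≈g)) ⟩
      z * (1# + embed g ^ 7)   ∎)

theorem5p1 :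
    ∀ {c ℓ₁ ℓ₂} (K : HeytingField c ℓ₁ ℓ₂) → CharacteristicZero K →
    (e : ℕ) .{{_ : NonZero e}} →
    let open Puiseux K e
        F₀ = generatingFunction (numWalks (+ 3) (+ 0))
        G₁ = generatingFunction (numWalks (+ 4) (+ 1))
    in
    (u₁ u₂ : Series) → IsSmallRoot u₁ → IsSmallRoot u₂ → u₁ ≉ u₂ →
    (F₀ ≈ - (u₁ * u₂ * (u₁ ^ 4 - u₂ ^ 4)) ÷ (z * (u₁ - u₂))) ×
    (G₁ ≈ (u₁ ^ 6 - u₂ ^ 6) ÷ (z * (u₁ - u₂)))
theorem5p1 K _ e u₁ u₂ small₁ small₂ u₁≉u₂ =
  (z*[u₁-u₂]≉0 ,
    -- At altitude 3 the powers are `u ^ 5` and the unknown `gf 3 1` is eliminated; at altitude 4,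
    -- below, they are `u ^ 6` and `gf 4 0` is eliminated.
    eliminate-F z u₁ u₂ (gf 3 0) (gf 3 1)
      (kernelEquation u₁ small₁ 3) (kernelEquation u₂ small₂ 3)) ,
  (z*[u₁-u₂]≉0 ,
    eliminate-G z u₁ u₂ (gf 4 0) (gf 4 1) {u₁ ^ 6} {u₂ ^ 6}
      (kernelEquation u₁ small₁ 4) (kernelEquation u₂ small₂ 4))
  where
  open Puiseux K e
  open Laurent K e using (ring; z⁻¹; z⁻¹*z≈1)
  open Elimination ring
  open SmallRoots K e
  gf : ℕ → ℕ → Series
  gf a b = generatingFunction (numWalks (+ a) (+ b))
  z*[u₁-u₂]≉0 : z * (u₁ - u₂) ≉ 0#
  z*[u₁-u₂]≉0 eq = u₁≉u₂ (unit*[x-y]≈0⇒x≈y z⁻¹ z u₁ u₂ z⁻¹*z≈1 eq)
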